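{- For integers $n\ge2$ and $0\le t\le n-2$, the number of $(102,011)$-avoiding inversion sequences $e$ of length $n$ with $\mathrm{rank}(e)=t$ is $F_{2n-2t-2}$, where $F_k$ denotes the $k$-th Fibonacci number ($F_0=0$, $F_1=1$, $F_k=F_{k-1}+F_{k-2}$).
   Context: An inversion sequence of length $n$ is an integer sequence $e=(e_1,\dots,e_n)$ with $0\le e_j\le j-1$ for all $j$. It contains a pattern $w=w_1w_2w_3$ if there are indices $i_1<i_2<i_3$ such that $e_{i_1}e_{i_2}e_{i_3}$ is order-isomorphic to $w$ (same relations $<,=,>$ between corresponding pairs of entries); otherwise it avoids $w$. "$(w,w')$-avoiding" means avoiding both $w$ and $w'$. $\max(e)$ is the largest entry, and $\mathrm{fdes}(e)$ is the position $p$ of the first descent: $e_1\le\cdots\le e_p>e_{p+1}$, with the convention $e_{n+1}=-1$. For a $102$-avoiding $e$, $\mathrm{rank}(e):=\mathrm{fdes}(e)-\max(e)-1$. -}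

module Defs where

open import Data.Fin as Fin using (toℕ)
open import Data.Integer as ℤ using (ℤ; +_)
open import Data.List using (List; length)
open import Data.List.Membership.Propositional using (_∈_)
open import Data.List.Relation.Unary.Unique.Propositional using (Unique)
open import Data.Nat using (ℕ; suc; _+_; _≤_; _<_; _⊔_; _≤?_)
open import Data.Bool using (if_then_else_)
open import Data.Product using (_×_; ∃-syntax; Σ-syntax)
open import Data.Vec using (Vec; []; _∷_; lookup; foldr′)
open import Function.Bundles using (_⇔_)
open import Relation.Binary.PropositionalEquality using (_≡_)
open import Relation.Nullary using (¬_; does)

-- The index i is 0-based, so e_j ≤ j - 1 with j = i + 1 becomes e_i ≤ i.
IsInversionSequence : ∀ {n} → Vec ℕ n → Set
IsInversionSequence e = ∀ i → lookup e i ≤ toℕ i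

-- The relation > is covered by exchanging a and b.
OrderIsomorphic : ∀ {k} → Vec ℕ k → Vec ℕ k → Set
OrderIsomorphic u w = ∀ a b →
  (lookup u a < lookup u b ⇔ lookup w a < lookup w b) ×
  (lookup u a ≡ lookup u b ⇔ lookup w a ≡ lookup w b)

Contains : ∀ {n} → Vec ℕ 3 → Vec ℕ n → Set
Contains w e = ∃[ i₁ ] ∃[ i₂ ] ∃[ i₃ ]
  (i₁ Fin.< i₂) × (i₂ Fin.< i₃) ×
  OrderIsomorphic (lookup e i₁ ∷ lookup e i₂ ∷ lookup e i₃ ∷ []) w

Avoids : ∀ {n} → Vec ℕ 3 → Vec ℕ n → Set
Avoids w e = ¬ Contains w e

-- For the empty vector this is 0.
max : ∀ {n} → Vec ℕ n → ℕ
max = foldr′ _⊔_ 0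

-- The 1-based position of the first descent. In a one-entry vector the
-- descent is the one to the conventional e_{n+1} = -1. The value on the
-- empty vector is arbitrary.
fdes : ∀ {n} → Vec ℕ n → ℕ
fdes []           = 0
fdes (x ∷ [])     = 1
fdes (x ∷ y ∷ ys) = if does (x ≤? y) then suc (fdes (y ∷ ys)) else 1

rank : ∀ {n} → Vec ℕ n → ℤ
rank e = + fdes e ℤ.- + max e ℤ.- + 1

fib : ℕ → ℕ
fib 0             = 0
fib 1             = 1
fib (suc (suc k)) = fib (suc k) + fib k

-- Exactly k elements satisfy P: they are listed without repetition by a
-- list of length k.
HasCardinality : ∀ {A : Set} → (A → Set) → ℕ → Set
HasCardinality {A} P k = Σ[ xs ∈ List A ]
  Unique xs × (∀ x → x ∈ xs ⇔ P x) × length xs ≡ k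

{-# OPTIONS --safe #-}
-- Deleting the unique maximum v of a nonzero (102,011)-avoiding inversion
-- sequence of rank t, at 0-based position i = v + t, leaves an avoiding sequence e that is
-- weakly increasing below i and has max e + t < i; every such pair (e , i) arises.
-- For a fixed length of e these pairs, taken at t, are the pairs at t + 1 together with
-- those having i = max e + t + 1, the latter being determined by e alone. The
-- sequences e that occur in such a tight pair are those of rank at least t
-- (all of them, including the zero sequence), so they split into rank exactly t,
-- which is again counted by pairs one entry shorter, and rank at least t + 1.
-- These two splittings are the recurrences of fib at even and at odd indices.
module Submission where

open import Defs
open import Data.Bool using (if_then_else_)
open import Data.Empty using (⊥-elim)
open import Data.Fin as Fin using (Fin; zero; suc; toℕ; fromℕ; fromℕ<; punchIn; punchOut)
open import Data.Fin.Properties as Fin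
  using (toℕ-injective; toℕ-fromℕ; toℕ-fromℕ<; toℕ<n; punchIn-mono-≤; punchIn-cancel-≤;
         punchIn-injective; punchIn-punchOut; punchInᵢ≢i)
open import Data.Fin.Patterns using (0F; 1F; 2F)
open import Data.Integer as ℤ using (+_)
import Data.Integer.Properties as ℤ
open import Data.Integer.Tactic.RingSolver using (solve-∀)
open import Data.List as List using ([]; _∷_; _++_)
open import Data.List.Membership.Propositional using (_∈_)
open import Data.List.Membership.Propositional.Properties
  using (∈-++⁺ˡ; ∈-++⁺ʳ; ∈-++⁻; ∈-map⁺; ∈-map⁻)
open import Data.List.Properties using (length-++; length-map)
open import Data.List.Relation.Unary.All as All using ([])
import Data.List.Relation.Unary.All.Properties as All
open import Data.List.Relation.Unary.AllPairs using ([]; _∷_)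
open import Data.List.Relation.Unary.Any using (here; there)
open import Data.List.Relation.Unary.Unique.Propositional using (Unique)
open import Data.List.Relation.Unary.Unique.Propositional.Properties using (++⁺)
open import Data.Nat
  using (ℕ; zero; suc; _+_; _*_; _∸_; _≤_; _<_; _≤?_; z≤n; s≤s; s≤s⁻¹; z<s; s<s)
open import Data.Nat.Properties
open import Data.Product using (_×_; _,_; proj₁; proj₂; ∃-syntax)
open import Data.Sum as Sum using (_⊎_; inj₁; inj₂; [_,_]′)
open import Data.Vec using (Vec; []; _∷_; lookup; insertAt; removeAt; replicate)
open import Data.Vec.Properties
  using (insertAt-lookup; insertAt-punchIn; insertAt-removeAt; removeAt-insertAt; lookup-replicate)
open import Data.Vec.Relation.Binary.Pointwise.Extensional using (ext; Pointwise-≡⇒≡)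
open import Function using (_∘_; case_of_)
open import Function.Bundles using (_⇔_; mk⇔; Equivalence)
open import Function.Properties.Equivalence using () renaming (trans to ⇔-trans)
open import Relation.Binary.Definitions using (tri<; tri≈; tri>)
open import Relation.Binary.PropositionalEquality
  using (_≡_; _≢_; refl; sym; trans; cong; cong₂; subst; subst₂; module ≡-Reasoning)
open import Relation.Nullary using (¬_; yes; no; contradiction)
open import Relation.Nullary.Decidable using (dec-true; dec-false)

open Equivalence using (to; from)

-- Finite cardinalities

module _ {A : Set} where

  card-cong : ∀ {P Q : A → Set} {k} → (∀ x → P x ⇔ Q x) →
              HasCardinality P k → HasCardinality Q k
  card-cong P⇔Q (xs , xs! , ∈⇔P , len) =
    xs , xs! , (λ x → ⇔-trans (∈⇔P x) (P⇔Q x)) , len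

  card-empty : ∀ {P : A → Set} → (∀ x → ¬ P x) → HasCardinality P 0
  card-empty ¬P = [] , [] , (λ x → mk⇔ (λ ()) (⊥-elim ∘ ¬P x)) , refl

  card-singleton : ∀ {P : A → Set} a → (∀ x → P x ⇔ x ≡ a) → HasCardinality P 1
  card-singleton a P⇔≡a =
    a ∷ [] , [] ∷ [] ,
    (λ x → mk⇔ (λ { (here x≡a) → from (P⇔≡a x) x≡a ; (there ()) }) (here ∘ to (P⇔≡a x))) , refl

  card-⊎ : ∀ {P Q : A → Set} {k l} → (∀ x → P x → ¬ Q x) →
           HasCardinality P k → HasCardinality Q l →
           HasCardinality (λ x → P x ⊎ Q x) (k + l)
  card-⊎ disj (xs , xs! , ∈⇔P , lenP) (ys , ys! , ∈⇔Q , lenQ) =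
    xs ++ ys ,
    ++⁺ xs! ys! (λ { {x} (x∈xs , x∈ys) → disj x (to (∈⇔P x) x∈xs) (to (∈⇔Q x) x∈ys) }) ,
    (λ x → mk⇔ (Sum.map (to (∈⇔P x)) (to (∈⇔Q x)) ∘ ∈-++⁻ xs)
               [ ∈-++⁺ˡ ∘ from (∈⇔P x) , ∈-++⁺ʳ xs ∘ from (∈⇔Q x) ]′) ,
    trans (length-++ xs) (cong₂ _+_ lenP lenQ)

module _ {A B : Set} (f : A → B) where

  -- Injectivity is asked only between members of the list: `insertPeak` will be injective only on
  -- insertable pairs.
  unique-map : ∀ {xs} → (∀ {x y} → x ∈ xs → y ∈ xs → f x ≡ f y → x ≡ y) →
               Unique xs → Unique (List.map f xs)
  unique-map inj []           = []
  unique-map inj (x∉xs ∷ xs!) =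
    All.map⁺ (All.tabulate λ y∈xs fx≡fy →
      All.lookup x∉xs y∈xs (inj (here refl) (there y∈xs) fx≡fy)) ∷
    unique-map (λ p q → inj (there p) (there q)) xs!

  card-image : ∀ {P : A → Set} {k} → (∀ {x y} → P x → P y → f x ≡ f y → x ≡ y) →
               HasCardinality P k → HasCardinality (λ y → ∃[ x ] P x × f x ≡ y) k
  card-image inj (xs , xs! , ∈⇔P , len) =
    List.map f xs ,
    unique-map (λ p q → inj (to (∈⇔P _) p) (to (∈⇔P _) q)) xs! ,
    (λ y → mk⇔
      (λ y∈ → case ∈-map⁻ f y∈ of λ { (x , x∈xs , y≡fx) → x , to (∈⇔P x) x∈xs , sym y≡fx })
      (λ { (x , Px , refl) → ∈-map⁺ f (from (∈⇔P x) Px) })) ,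
    trans (length-map f xs) len

-- Positions around a hole

-- A view of `Fin (suc n)` for case analysis on the entries of `insertAt e i v`: the inserted entry,
-- or an old one at `punchIn i j`.
data AroundHole {n} (i : Fin (suc n)) : Fin (suc n) → Set where
  hole    : AroundHole i i
  outside : ∀ j → AroundHole i (punchIn i j)

aroundHole : ∀ {n} (i j : Fin (suc n)) → AroundHole i j
aroundHole i j with i Fin.≟ j
... | yes refl = hole
... | no  i≢j  = subst (AroundHole i) (punchIn-punchOut i≢j) (outside (punchOut i≢j))

punchIn-mono-< : ∀ {n} (i : Fin (suc n)) {j k} → j Fin.< k → punchIn i j Fin.< punchIn i k
punchIn-mono-< i j<k = ≰⇒> (<⇒≱ j<k ∘ punchIn-cancel-≤ i _ _)

punchIn-cancel-< : ∀ {n} (i : Fin (suc n)) {j k} → punchIn i j Fin.< punchIn i k → j Fin.< k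
punchIn-cancel-< i j<k = ≰⇒> (<⇒≱ j<k ∘ punchIn-mono-≤ i _ _)

toℕ≤toℕ-punchIn : ∀ {n} (i : Fin (suc n)) j → toℕ j ≤ toℕ (punchIn i j)
toℕ≤toℕ-punchIn zero    j       = n≤1+n _
toℕ≤toℕ-punchIn (suc i) zero    = z≤n
toℕ≤toℕ-punchIn (suc i) (suc j) = s≤s (toℕ≤toℕ-punchIn i j)

toℕ-punchIn-< : ∀ {n} (i : Fin (suc n)) j → toℕ j < toℕ i → toℕ (punchIn i j) ≡ toℕ j
toℕ-punchIn-< (suc i) zero    _         = refl
toℕ-punchIn-< (suc i) (suc j) (s≤s j<i) = cong suc (toℕ-punchIn-< i j j<i)

-- Maximum and first descent

lookup≤max : ∀ {n} (e : Vec ℕ n) i → lookup e i ≤ max e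
lookup≤max (x ∷ e) zero    = m≤m⊔n x (max e)
lookup≤max (x ∷ e) (suc i) = ≤-trans (lookup≤max e i) (m≤n⊔m x (max e))

max-lub : ∀ {n b} (e : Vec ℕ n) → (∀ i → lookup e i ≤ b) → max e ≤ b
max-lub []      _  = z≤n
max-lub (x ∷ e) ≤b = ⊔-lub (≤b zero) (max-lub e (≤b ∘ suc))

-- The hypothesis `0 < b` covers the empty vector, whose `max` is 0.
max-lub-< : ∀ {n b} → 0 < b → (e : Vec ℕ n) → (∀ i → lookup e i < b) → max e < b
max-lub-< 0<b []      _  = 0<b
max-lub-< 0<b (x ∷ e) <b = ⊔-pres-<m (<b zero) (max-lub-< 0<b e (<b ∘ suc))

max-attained : ∀ {n} (e : Vec ℕ (suc n)) → ∃[ i ] lookup e i ≡ max e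
max-attained (x ∷ [])    = zero , sym (⊔-identityʳ x)
max-attained (x ∷ e@(_ ∷ _)) with max-attained e | ⊔-sel x (max e)
... | _       | inj₁ eq = zero  , sym eq
... | i , eqᵢ | inj₂ eq = suc i , trans eqᵢ (sym eq)

-- The bound is a natural number so that it can lie one past the last index.
SortedBelow : ∀ {n} → ℕ → Vec ℕ n → Set
SortedBelow p e = ∀ j k → toℕ j < toℕ k → toℕ k < p → lookup e j ≤ lookup e k

-- Sortedness makes `fdes` walk through to `i`. There it stops, either at a smaller next entry or at
-- the end of the vector, where the conventional -1 follows. The `suc` turns the 0-based index into
-- a 1-based position.
fdes-peak : ∀ {n} (e : Vec ℕ (suc n)) i → SortedBelow (suc (toℕ i)) e →
            (∀ j → i Fin.< j → lookup e j < lookup e i) → fdes e ≡ suc (toℕ i)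
fdes-peak (x ∷ [])     zero    _    _    = refl
fdes-peak (x ∷ y ∷ ys) zero    _    desc =
  cong (λ b → if b then suc (fdes (y ∷ ys)) else 1)
    (dec-false (x ≤? y) (<⇒≱ (desc (suc zero) z<s)))
fdes-peak (x ∷ y ∷ ys) (suc i) sort desc =
  trans
    (cong (λ b → if b then suc (fdes (y ∷ ys)) else 1)
      (dec-true (x ≤? y) (sort zero (suc zero) z<s (s<s z<s))))
    (cong suc (fdes-peak (y ∷ ys) i
      (λ j k j<k k≤i → sort (suc j) (suc k) (s<s j<k) (s<s k≤i))
      (λ j i<j → desc (suc j) (s<s i<j))))

-- Strict maxima

IsTop : ∀ {n} → Vec ℕ n → Fin n → Set
IsTop e i = ∀ j → j ≢ i → lookup e j < lookup e i

top-unique : ∀ {n} (e : Vec ℕ n) {i j} → IsTop e i → IsTop e j → i ≡ j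
top-unique e {i} {j} topᵢ topⱼ with i Fin.≟ j
... | yes i≡j = i≡j
... | no  i≢j = contradiction (topᵢ j (i≢j ∘ sym)) (<-asym (topⱼ i i≢j))

top-max : ∀ {n} (e : Vec ℕ n) {i} → IsTop e i → max e ≡ lookup e i
top-max e {i} top = ≤-antisym (max-lub e below) (lookup≤max e i)
  where
  below : ∀ j → lookup e j ≤ lookup e i
  below j with j Fin.≟ i
  ... | yes refl = ≤-refl
  ... | no  j≢i  = <⇒≤ (top j j≢i)

-- Avoiding sequences

-- Avoidance in a form that passes easily through insertion and deletion: after a drop, no entry
-- exceeds the larger entry of that drop, and positive values do not repeat.
record Valid {n} (e : Vec ℕ n) : Set where
  field
    bounded : IsInversionSequence e
    no102   : ∀ i j k → i Fin.< j → j Fin.< k → lookup e j < lookup e i → lookup e k ≤ lookup e i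
    no011   : ∀ i j → i ≢ j → lookup e i ≡ lookup e j → lookup e i ≡ 0

open Valid

-- Pattern avoidance in terms of inequalities

SameOrder : ℕ → ℕ → ℕ → ℕ → Set
SameOrder x y x′ y′ = (x < y ⇔ x′ < y′) × (x ≡ y ⇔ x′ ≡ y′)

same-< : ∀ {x y x′ y′} → x < y → x′ < y′ → SameOrder x y x′ y′
same-< x<y x′<y′ =
  mk⇔ (λ _ → x′<y′) (λ _ → x<y) ,
  mk⇔ (λ eq → contradiction eq (<⇒≢ x<y)) (λ eq → contradiction eq (<⇒≢ x′<y′))

same-> : ∀ {x y x′ y′} → y < x → y′ < x′ → SameOrder x y x′ y′
same-> y<x y′<x′ =
  mk⇔ (λ lt → contradiction lt (<-asym y<x)) (λ lt → contradiction lt (<-asym y′<x′)) ,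
  mk⇔ (λ eq → contradiction (sym eq) (<⇒≢ y<x)) (λ eq → contradiction (sym eq) (<⇒≢ y′<x′))

same-≡ : ∀ {x y x′ y′} → x ≡ y → x′ ≡ y′ → SameOrder x y x′ y′
same-≡ refl refl =
  mk⇔ (λ lt → contradiction lt (<-irrefl refl)) (λ lt → contradiction lt (<-irrefl refl)) ,
  mk⇔ (λ _ → refl) (λ _ → refl)

orderIsomorphic-102 : ∀ {a b c} → b < a → a < c →
                      OrderIsomorphic (a ∷ b ∷ c ∷ []) (1 ∷ 0 ∷ 2 ∷ [])
orderIsomorphic-102 b<a a<c 0F 0F = same-≡ refl refl
orderIsomorphic-102 b<a a<c 0F 1F = same-> b<a z<s
orderIsomorphic-102 b<a a<c 0F 2F = same-< a<c (s<s z<s)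
orderIsomorphic-102 b<a a<c 1F 0F = same-< b<a z<s
orderIsomorphic-102 b<a a<c 1F 1F = same-≡ refl refl
orderIsomorphic-102 b<a a<c 1F 2F = same-< (<-trans b<a a<c) z<s
orderIsomorphic-102 b<a a<c 2F 0F = same-> a<c (s<s z<s)
orderIsomorphic-102 b<a a<c 2F 1F = same-> (<-trans b<a a<c) z<s
orderIsomorphic-102 b<a a<c 2F 2F = same-≡ refl refl

orderIsomorphic-011 : ∀ {a b c} → a < b → b ≡ c →
                      OrderIsomorphic (a ∷ b ∷ c ∷ []) (0 ∷ 1 ∷ 1 ∷ [])
orderIsomorphic-011 a<b refl 0F 0F = same-≡ refl refl
orderIsomorphic-011 a<b refl 0F 1F = same-< a<b z<s
orderIsomorphic-011 a<b refl 0F 2F = same-< a<b z<s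
orderIsomorphic-011 a<b refl 1F 0F = same-> a<b z<s
orderIsomorphic-011 a<b refl 1F 1F = same-≡ refl refl
orderIsomorphic-011 a<b refl 1F 2F = same-≡ refl refl
orderIsomorphic-011 a<b refl 2F 0F = same-> a<b z<s
orderIsomorphic-011 a<b refl 2F 1F = same-≡ refl refl
orderIsomorphic-011 a<b refl 2F 2F = same-≡ refl refl

valid⇒avoids-102 : ∀ {n} {e : Vec ℕ n} → Valid e → Avoids (1 ∷ 0 ∷ 2 ∷ []) e
valid⇒avoids-102 V (i , j , k , i<j , j<k , iso) =
  <⇒≱ (from (proj₁ (iso 0F 2F)) (s<s z<s)) (no102 V i j k i<j j<k (from (proj₁ (iso 1F 0F)) z<s))

-- The two equal letters would be 0, and no entry lies below 0.
valid⇒avoids-011 : ∀ {n} {e : Vec ℕ n} → Valid e → Avoids (0 ∷ 1 ∷ 1 ∷ []) e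
valid⇒avoids-011 {e = e} V (i , j , k , i<j , j<k , iso) =
  n≮0 (subst (lookup e i <_) (no011 V j k (Fin.<⇒≢ j<k) (from (proj₂ (iso 1F 2F)) refl))
    (from (proj₁ (iso 0F 1F)) z<s))

-- A repeated positive entry forms the pattern 011 with the initial entry, which is 0.
avoids-011⇒repeat-zero : ∀ {n} (e : Vec ℕ n) → IsInversionSequence e →
                         Avoids (0 ∷ 1 ∷ 1 ∷ []) e →
                         ∀ i j → i Fin.< j → lookup e i ≡ lookup e j → lookup e i ≡ 0
avoids-011⇒repeat-zero e inv av zero j _ _ = n≤0⇒n≡0 (inv zero)
avoids-011⇒repeat-zero (x ∷ _) inv av (suc i) j i<j eq with n≤0⇒n≡0 (inv zero)
... | refl = n≤0⇒n≡0 (≮⇒≥ λ 0<eᵢ →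
  av (zero , suc i , j , z<s , i<j , orderIsomorphic-011 0<eᵢ eq))

avoids⇒valid : ∀ {n} {e : Vec ℕ n} → IsInversionSequence e →
               Avoids (1 ∷ 0 ∷ 2 ∷ []) e → Avoids (0 ∷ 1 ∷ 1 ∷ []) e → Valid e
avoids⇒valid {e = e} inv av102 av011 = record
  { bounded = inv
  ; no102   = λ i j k i<j j<k eⱼ<eᵢ → ≮⇒≥ λ eᵢ<eₖ →
      av102 (i , j , k , i<j , j<k , orderIsomorphic-102 eⱼ<eᵢ eᵢ<eₖ)
  ; no011   = repeat
  }
  where
  repeat : ∀ i j → i ≢ j → lookup e i ≡ lookup e j → lookup e i ≡ 0
  repeat i j i≢j eq with Fin.<-cmp i j
  ... | tri< i<j _ _ = avoids-011⇒repeat-zero e inv av011 i j i<j eq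
  ... | tri≈ _ i≡j _ = contradiction i≡j i≢j
  ... | tri> _ _ j<i = trans eq (avoids-011⇒repeat-zero e inv av011 j i j<i (sym eq))

max≡0⇒sorted : ∀ {n p} (e : Vec ℕ n) → max e ≡ 0 → SortedBelow p e
max≡0⇒sorted e max≡0 j k _ _ = ≤-trans (lookup≤max e j) (≤-trans (≤-reflexive max≡0) z≤n)

valid-replicate-zero : ∀ n → Valid (replicate n 0)
valid-replicate-zero n = record
  { bounded = λ i → ≤-trans (≤-reflexive (zeros i)) z≤n
  ; no102   = λ i j k _ _ _ → ≤-trans (≤-reflexive (zeros k)) z≤n
  ; no011   = λ i j _ _ → zeros i
  }
  where
  zeros : ∀ i → lookup (replicate n 0) i ≡ 0
  zeros i = lookup-replicate i 0

-- A second occurrence of the maximum would be a repeated value, hence 0 by `no011`.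
max-top : ∀ {n} {e : Vec ℕ n} {i} → Valid e → 0 < max e → lookup e i ≡ max e → IsTop e i
max-top {e = e} {i} V 0<max eq j j≢i =
  ≤∧≢⇒< (subst (lookup e j ≤_) (sym eq) (lookup≤max e j))
        (λ eⱼ≡eᵢ → <⇒≢ 0<max (trans (sym (no011 V i j (j≢i ∘ sym) (sym eⱼ≡eᵢ))) eq))

-- A drop before the top would form the pattern 102 together with the top.
sorted-before-top : ∀ {n} {e : Vec ℕ n} {i} → Valid e → IsTop e i →
                    SortedBelow (suc (toℕ i)) e
sorted-before-top {e = e} {i} V top j k j<k k≤i with k Fin.≟ i
... | yes refl = <⇒≤ (top j (Fin.<⇒≢ j<k))
... | no  k≢i  = ≮⇒≥ λ eₖ<eⱼ →
  <⇒≱ (top j (Fin.<⇒≢ (Fin.<-trans j<k k<i))) (no102 V j k i j<k k<i eₖ<eⱼ)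
  where
  k<i : k Fin.< i
  k<i = ≤∧≢⇒< (s≤s⁻¹ k≤i) (k≢i ∘ toℕ-injective)

-- Inserting and deleting the maximum

module _ {n} (e : Vec ℕ n) (i : Fin (suc n)) (v : ℕ) where

  private
    ê : Vec ℕ (suc n)
    ê = insertAt e i v

    ê-hole : lookup ê i ≡ v
    ê-hole = insertAt-lookup e i v

    ê-outside : ∀ j → lookup ê (punchIn i j) ≡ lookup e j
    ê-outside = insertAt-punchIn e i v

  insert-top : max e < v → IsTop ê i
  insert-top max<v j j≢i with aroundHole i j
  ... | hole       = contradiction refl j≢i
  ... | outside j′ = subst₂ _<_ (sym (ê-outside j′)) (sym ê-hole) (≤-<-trans (lookup≤max e j′) max<v)

  top⇒max< : 0 < v → IsTop ê i → max e < v
  top⇒max< 0<v top = max-lub-< 0<v e λ j →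
    subst₂ _<_ (ê-outside j) ê-hole (top (punchIn i j) (punchInᵢ≢i i j))

  -- Being a strict maximum, `v` can only play the 2 of a 102, and the 1 and 0 would then be a drop
  -- below `i`, which sortedness excludes. It cannot be a repeated value either.
  valid-insert : max e < v → v ≤ toℕ i → Valid e → SortedBelow (toℕ i) e → Valid ê
  valid-insert max<v v≤i V sorted = record { bounded = bnd ; no102 = n102 ; no011 = n011 }
    where
    top : IsTop ê i
    top = insert-top max<v

    ê≤v : ∀ j → lookup ê j ≤ lookup ê i
    ê≤v j = subst (lookup ê j ≤_) (top-max ê top) (lookup≤max ê j)

    bnd : IsInversionSequence ê
    bnd j with aroundHole i j
    ... | hole       = subst (_≤ toℕ i) (sym ê-hole) v≤i
    ... | outside j′ = subst (_≤ toℕ (punchIn i j′)) (sym (ê-outside j′))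
                         (≤-trans (bounded V j′) (toℕ≤toℕ-punchIn i j′))

    n102 : ∀ a b c → a Fin.< b → b Fin.< c → lookup ê b < lookup ê a → lookup ê c ≤ lookup ê a
    n102 a b c a<b b<c b<a with aroundHole i a | aroundHole i b | aroundHole i c
    ... | hole       | _          | _    = ê≤v c
    ... | outside _  | hole       | _    = contradiction b<a (≤⇒≯ (ê≤v a))
    ... | outside a′ | outside b′ | hole = contradiction
      (subst₂ _<_ (ê-outside b′) (ê-outside a′) b<a)
      (≤⇒≯ (sorted a′ b′ (punchIn-cancel-< i a<b) (≤-<-trans (toℕ≤toℕ-punchIn i b′) b<c)))
    ... | outside a′ | outside b′ | outside c′ =
      subst₂ _≤_ (sym (ê-outside c′)) (sym (ê-outside a′))
        (no102 V a′ b′ c′ (punchIn-cancel-< i a<b) (punchIn-cancel-< i b<c)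
          (subst₂ _<_ (ê-outside b′) (ê-outside a′) b<a))

    n011 : ∀ a b → a ≢ b → lookup ê a ≡ lookup ê b → lookup ê a ≡ 0
    n011 a b a≢b eq with aroundHole i a | aroundHole i b
    ... | hole       | _          = contradiction (sym eq) (<⇒≢ (top b (a≢b ∘ sym)))
    ... | outside _  | hole       = contradiction eq (<⇒≢ (top a a≢b))
    ... | outside a′ | outside b′ =
      trans (ê-outside a′)
        (no011 V a′ b′ (a≢b ∘ cong (punchIn i))
          (trans (sym (ê-outside a′)) (trans eq (ê-outside b′))))

  sorted-delete : SortedBelow (suc (toℕ i)) ê → SortedBelow (toℕ i) e
  sorted-delete sorted j k j<k k<i =
    subst₂ _≤_ (ê-outside j) (ê-outside k)
      (sorted (punchIn i j) (punchIn i k) (punchIn-mono-< i j<k)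
        (≤-trans (s≤s (≤-reflexive (toℕ-punchIn-< i k k<i))) (m≤n⇒m≤1+n k<i)))

  valid-delete : max e < v → Valid ê → Valid e
  valid-delete max<v V = record { bounded = bnd ; no102 = n102 ; no011 = n011 }
    where
    bnd : IsInversionSequence e
    bnd j with toℕ j <? toℕ i
    ... | yes j<i = subst₂ _≤_ (ê-outside j) (toℕ-punchIn-< i j j<i) (bounded V (punchIn i j))
    -- An entry behind the hole moves one place to the left, so its old bound is too weak by one.
    -- Instead it is less than `v`, and `v ≤ i ≤ j`.
    ... | no  j≮i = ≤-trans (lookup≤max e j) (≤-trans (<⇒≤ max<v)
                      (≤-trans (subst (_≤ toℕ i) ê-hole (bounded V i)) (≮⇒≥ j≮i)))

    n102 : ∀ a b c → a Fin.< b → b Fin.< c → lookup e b < lookup e a → lookup e c ≤ lookup e a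
    n102 a b c a<b b<c b<a =
      subst₂ _≤_ (ê-outside c) (ê-outside a)
        (no102 V (punchIn i a) (punchIn i b) (punchIn i c)
          (punchIn-mono-< i a<b) (punchIn-mono-< i b<c)
          (subst₂ _<_ (sym (ê-outside b)) (sym (ê-outside a)) b<a))

    n011 : ∀ a b → a ≢ b → lookup e a ≡ lookup e b → lookup e a ≡ 0
    n011 a b a≢b eq =
      trans (sym (ê-outside a))
        (no011 V (punchIn i a) (punchIn i b) (a≢b ∘ punchIn-injective i a b)
          (trans (ê-outside a) (trans eq (sym (ê-outside b)))))

-- The three families of the recurrence

-- For nonzero valid sequences this is rank `t`: the first descent comes right after the top.
record Peak {n} (t : ℕ) (e : Vec ℕ n) : Set where
  constructor peak
  field
    valid    : Valid e
    position : Fin n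
    top      : IsTop e position
    positive : 0 < lookup e position
    offset   : toℕ position ≡ lookup e position + t

-- Rank at least `t`, expressed without `fdes`: index `max e + t` exists, and the entries up to and
-- including it are sorted.
record Early {n} (t : ℕ) (e : Vec ℕ n) : Set where
  constructor early
  field
    valid  : Valid e
    room   : max e + t < n
    sorted : SortedBelow (suc (max e + t)) e

-- The value to be inserted is `i - t`; `late` says that it exceeds `max e`, avoiding subtraction.
record Insertable {m} (t : ℕ) (x : Vec ℕ m × Fin (suc m)) : Set where
  constructor insertable
  field
    valid  : Valid (proj₁ x)
    late   : max (proj₁ x) + t < toℕ (proj₂ x)
    sorted : SortedBelow (toℕ (proj₂ x)) (proj₁ x)

insertPeak : ∀ {m} → ℕ → Vec ℕ m × Fin (suc m) → Vec ℕ (suc m)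
insertPeak t (e , i) = insertAt e i (toℕ i ∸ t)

insertPeak-max< : ∀ {m t} {x : Vec ℕ m × Fin (suc m)} → Insertable t x →
                  max (proj₁ x) < toℕ (proj₂ x) ∸ t
insertPeak-max< {t = t} {e , i} (insertable _ late _) =
  subst (_< toℕ i ∸ t) (m+n∸n≡m (max e) t) (∸-monoˡ-< late (m≤n+m t (max e)))

insertPeak-peak : ∀ {m t} (x : Vec ℕ m × Fin (suc m)) → Insertable t x → Peak t (insertPeak t x)
insertPeak-peak {t = t} (e , i) I@(insertable V late sorted) = record
  { valid    = valid-insert e i _ max<v (m∸n≤m (toℕ i) t) V sorted
  ; position = i
  ; top      = insert-top e i _ max<v
  ; positive = subst (0 <_) (sym v-eq) (≤-<-trans z≤n max<v)
  ; offset   = sym (trans (cong (_+ t) v-eq) (m∸n+n≡m (≤-trans (m≤n+m t (max e)) (<⇒≤ late))))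
  }
  where
  max<v = insertPeak-max< I
  v-eq = insertAt-lookup e i (toℕ i ∸ t)

-- The image determines `i` as the position of its unique top, and removing that entry recovers `e`.
insertPeak-injective : ∀ {m t} {x y : Vec ℕ m × Fin (suc m)} → Insertable t x → Insertable t y →
                       insertPeak t x ≡ insertPeak t y → x ≡ y
insertPeak-injective {t = t} {e , i} {e′ , i′} I I′ eq
  with top-unique (insertPeak t (e , i))
        (insert-top e i _ (insertPeak-max< I))
        (subst (λ z → IsTop z i′) (sym eq) (insert-top e′ i′ _ (insertPeak-max< I′)))
... | refl = cong (_, i) (trans (sym (removeAt-insertAt e i (toℕ i ∸ t)))
               (trans (cong (λ z → removeAt z i) eq) (removeAt-insertAt e′ i (toℕ i ∸ t))))

-- The preimage is the sequence without its top, paired with the position of the top; `offset`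
-- recovers the deleted value as `i - t`.
peak⇒insertPeak : ∀ {m t} (e : Vec ℕ (suc m)) → Peak t e →
                  ∃[ x ] Insertable t x × insertPeak t x ≡ e
peak⇒insertPeak {t = t} e (peak V i top pos off) =
  (e′ , i) ,
  insertable
    (valid-delete e′ i v max<v (subst Valid (sym e≡) V))
    (subst (max e′ + t <_) (sym off) (+-monoˡ-< t max<v))
    (sorted-delete e′ i v (subst (SortedBelow (suc (toℕ i))) (sym e≡) (sorted-before-top V top))) ,
  trans (cong (insertAt e′ i) (trans (cong (_∸ t) off) (m+n∸n≡m v t))) e≡
  where
  e′ = removeAt e i
  v  = lookup e i
  e≡ : insertAt e′ i v ≡ e
  e≡ = insertAt-removeAt e i
  max<v : max e′ < v
  max<v = top⇒max< e′ i v pos (subst (λ z → IsTop z i) (sym e≡) top)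

insertPeak⇔peak : ∀ {m t} (e : Vec ℕ (suc m)) →
                  (∃[ x ] Insertable t x × insertPeak t x ≡ e) ⇔ Peak t e
insertPeak⇔peak {t = t} e =
  mk⇔ (λ { (x , I , eq) → subst (Peak t) eq (insertPeak-peak x I) }) (peak⇒insertPeak e)

card-peak : ∀ {m t k} → HasCardinality (Insertable {m} t) k → HasCardinality (Peak {suc m} t) k
card-peak {t = t} = card-cong insertPeak⇔peak ∘ card-image (insertPeak t) insertPeak-injective

-- If the top came before index `max e + t`, the entry at that index would be at least as large by
-- sortedness.
early-top-≤ : ∀ {n t} {e : Vec ℕ n} {i} → Early t e → IsTop e i → max e + t ≤ toℕ i
early-top-≤ {t = t} {e} {i} (early _ room sorted) top = ≮⇒≥ λ i<max+t →
  let i<k = subst (toℕ i <_) (sym k≡) i<max+t in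
  <⇒≱ (top k (Fin.<⇒≢ i<k ∘ sym)) (sorted i k i<k (s≤s (≤-reflexive k≡)))
  where
  k = fromℕ< room
  k≡ : toℕ k ≡ max e + t
  k≡ = toℕ-fromℕ< room

peak⇒early : ∀ {n t} {e : Vec ℕ n} → Peak t e → Early t e
peak⇒early {n} {t} {e} (peak V i top pos off) =
  early V (subst (_< n) i≡ (toℕ<n i))
    (subst (λ p → SortedBelow (suc p) e) i≡ (sorted-before-top V top))
  where
  i≡ : toℕ i ≡ max e + t
  i≡ = trans off (cong (_+ t) (sym (top-max e top)))

early-suc⇒early : ∀ {n t} {e : Vec ℕ n} → Early (suc t) e → Early t e
early-suc⇒early {n} {t} {e} (early V room sorted) =
  early V (≤-trans (s≤s t≤) room) λ j k j<k k< → sorted j k j<k (≤-trans k< (s≤s t≤))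
  where
  t≤ : max e + t ≤ max e + suc t
  t≤ = +-monoʳ-≤ (max e) (n≤1+n t)

-- The top would be at index `max e + t` and also no earlier than `max e + t + 1`.
peak-early-disjoint : ∀ {n t} (e : Vec ℕ n) → Peak t e → ¬ Early (suc t) e
peak-early-disjoint {t = t} e (peak V i top pos off) E =
  <⇒≱ (+-monoʳ-< (max e) (n<1+n t))
      (subst (max e + suc t ≤_) (trans off (cong (_+ t) (sym (top-max e top))))
        (early-top-≤ E top))

-- A zero sequence goes to the right, with `t < m` giving the room. Otherwise there is a top at
-- index `max e + t` or later: equality gives a peak, and a later top leaves a sorted prefix longer
-- by one.
early-split : ∀ {m t} (e : Vec ℕ (suc m)) → t < m → Early t e → Peak t e ⊎ Early (suc t) e
early-split {m} {t} e t<m E@(early V _ _) with max-attained e | max e ≟ 0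
... | _      | yes max≡0 = inj₂ (early V
  (subst (λ z → z + suc t < suc m) (sym max≡0) (s≤s t<m)) (max≡0⇒sorted e max≡0))
... | i , eq | no max≢0 = [ inj₂ ∘ later , inj₁ ∘ now ]′ (m≤n⇒m<n∨m≡n (early-top-≤ E top))
  where
  0<max : 0 < max e
  0<max = n≢0⇒n>0 max≢0

  top : IsTop e i
  top = max-top V 0<max eq

  now : max e + t ≡ toℕ i → Peak t e
  now max+t≡i =
    peak V i top (subst (0 <_) (sym eq) 0<max) (trans (sym max+t≡i) (cong (_+ t) (sym eq)))

  later : max e + t < toℕ i → Early (suc t) e
  later max+t<i = early V (≤-<-trans max+t+1≤i (toℕ<n i))
    λ j k j<k k< → sorted-before-top V top j k j<k (≤-trans k< (s≤s max+t+1≤i))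
    where
    max+t+1≤i : max e + suc t ≤ toℕ i
    max+t+1≤i = subst (_≤ toℕ i) (sym (+-suc (max e) t)) max+t<i

-- At length `t + 1` the condition `room` forces `max e` to be 0.
early⇔zero : ∀ {t} (e : Vec ℕ (suc t)) → Early t e ⇔ e ≡ replicate (suc t) 0
early⇔zero {t} e = mk⇔ zeros λ { refl →
    early (valid-replicate-zero (suc t)) (s≤s (≤-reflexive (cong (_+ t) max≡0)))
      (max≡0⇒sorted (replicate (suc t) 0) max≡0) }
  where
  max≡0 : max (replicate (suc t) 0) ≡ 0
  max≡0 = n≤0⇒n≡0 (max-lub (replicate (suc t) 0) (λ i → ≤-reflexive (lookup-replicate i 0)))

  zeros : Early t e → e ≡ replicate (suc t) 0
  zeros E = Pointwise-≡⇒≡ (ext λ i →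
    trans (n≤0⇒n≡0 (≤-trans (lookup≤max e i) (+-cancelʳ-≤ t (max e) 0 (s≤s⁻¹ (Early.room E)))))
          (sym (lookup-replicate i 0)))

-- Here the value to be inserted is `max e + 1`, the least one allowed.
Tight : ∀ {m} → ℕ → Vec ℕ m × Fin (suc m) → Set
Tight t x = Insertable t x × toℕ (proj₂ x) ≡ suc (max (proj₁ x) + t)

insertable-split : ∀ {m t} (x : Vec ℕ m × Fin (suc m)) →
                   (Insertable (suc t) x ⊎ Tight t x) ⇔ Insertable t x
insertable-split {t = t} (e , i) = mk⇔
  [ (λ { (insertable V late sorted) →
         insertable V (<-trans (+-monoʳ-< (max e) (n<1+n t)) late) sorted }) , proj₁ ]′
  (λ { I@(insertable V late sorted) → case m≤n⇒m<n∨m≡n late of λ where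
         (inj₁ later) → inj₁ (insertable V (subst (_< toℕ i) (sym (+-suc (max e) t)) later) sorted)
         (inj₂ tight) → inj₂ (I , sym tight) })

insertable-tight-disjoint : ∀ {m t} (x : Vec ℕ m × Fin (suc m)) →
                            Insertable (suc t) x → ¬ Tight t x
insertable-tight-disjoint {t = t} (e , i) I (_ , i≡) =
  <⇒≢ (Insertable.late I) (trans (+-suc (max e) t) (sym i≡))

-- The cap m only makes the position total: it is inactive on Early sequences.
tighten : ∀ {m} → ℕ → Vec ℕ m → Vec ℕ m × Fin (suc m)
tighten {m} t e = e , fromℕ< (s≤s (m⊓n≤n (suc (max e + t)) m))

toℕ-tighten : ∀ {m t} (e : Vec ℕ m) → max e + t < m →
              toℕ (proj₂ (tighten t e)) ≡ suc (max e + t)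
toℕ-tighten {m} {t} e room =
  trans (toℕ-fromℕ< (s≤s (m⊓n≤n (suc (max e + t)) m))) (m≤n⇒m⊓n≡m room)

-- With `i = max e + t + 1`, the bound `i ≤ m` is `room`, and the two sortedness conditions
-- coincide.
early-tighten⇔tight : ∀ {m t} (x : Vec ℕ m × Fin (suc m)) →
                      (∃[ e ] Early t e × tighten t e ≡ x) ⇔ Tight t x
early-tighten⇔tight {m} {t} (e , i) = mk⇔
  (λ { (e , early V room sorted , refl) →
       let eq = toℕ-tighten {t = t} e room in
       insertable V (≤-reflexive (sym eq)) (subst (λ p → SortedBelow p e) (sym eq) sorted) , eq })
  (λ { (insertable V late sorted , i≡) →
       let room = subst (_≤ m) i≡ (s≤s⁻¹ (toℕ<n i)) in
       e , early V room (subst (λ p → SortedBelow p e) i≡ sorted) ,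
       cong (e ,_) (toℕ-injective (trans (toℕ-tighten {t = t} e room) (sym i≡))) })

card-tight : ∀ {m t k} → HasCardinality (Early {m} t) k → HasCardinality (Tight {m} t) k
card-tight {t = t} =
  card-cong early-tighten⇔tight ∘ card-image (tighten t) (λ _ _ → cong proj₁)

-- Fibonacci counts by mutual recursion

fib-even-suc : ∀ d → fib (suc d + suc d) ≡ fib (d + d) + fib (suc (d + d))
fib-even-suc d = trans (cong (fib ∘ suc) (+-suc d d)) (+-comm (fib (suc (d + d))) (fib (d + d)))

fib-odd-suc : ∀ d → fib (suc (suc d + suc d)) ≡ fib (suc d + suc d) + fib (suc (d + d))
fib-odd-suc d = cong (λ k → fib (suc d + suc d) + fib k) (+-suc d d)

-- The parameter `d` measures the excess of the length over `t`. Raising `t` by one at fixed length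
-- lowers `d` by one; `card-early` at `suc d` calls `card-insertable` at the same `suc d`, which
-- descends to `d`.
card-insertable : ∀ d {m t} → m ≡ d + t → HasCardinality (Insertable {m} t) (fib (d + d))
card-early      : ∀ d {n t} → n ≡ suc d + t → HasCardinality (Early {n} t) (fib (suc (d + d)))

-- With `m = t`, an insertable position would have to exceed `t`, but positions are at most `m`.
card-insertable zero    {t = t} refl = card-empty λ { (e , i) (insertable _ late _) →
  <⇒≱ (≤-<-trans (m≤n+m t (max e)) late) (s≤s⁻¹ (toℕ<n i)) }
card-insertable (suc d) {t = t} refl =
  subst (HasCardinality _) (sym (fib-even-suc d))
    (card-cong insertable-split
      (card-⊎ insertable-tight-disjoint
        (card-insertable d (sym (+-suc d t))) (card-tight (card-early d refl))))

card-early zero    {t = t} refl = card-singleton (replicate (suc t) 0) early⇔zero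
card-early (suc d) {t = t} refl =
  subst (HasCardinality _) (sym (fib-odd-suc d))
    (card-cong (λ e → mk⇔ [ peak⇒early , early-suc⇒early ]′ (early-split e (s≤s (m≤n+m t d))))
      (card-⊎ peak-early-disjoint
        (card-peak (card-insertable (suc d) refl))
        (card-early d (cong suc (sym (+-suc d t))))))

-- Peak and rank

-- Moves the integer subtractions across, so that rank can be compared with `offset` over the
-- naturals; the 1 in `rank` cancels the shift from 0-based `a` to a 1-based position.
rank⇔ : ∀ {n a t} (e : Vec ℕ n) → fdes e ≡ suc a → rank e ≡ + t ⇔ a ≡ max e + t
rank⇔ {a = a} {t} e fdes≡ rewrite fdes≡ = mk⇔
  (λ eq → ℤ.+-injective (trans (lemma₁ (+ a) (+ max e)) (cong (ℤ._+_ (+ max e)) eq)))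
  (λ { refl → lemma₂ (+ max e) (+ t) })
  where
  lemma₁ : ∀ i j → i ≡ j ℤ.+ (+ 1 ℤ.+ i ℤ.- j ℤ.- + 1)
  lemma₁ = solve-∀
  lemma₂ : ∀ i j → + 1 ℤ.+ (i ℤ.+ j) ℤ.- i ℤ.- + 1 ≡ j
  lemma₂ = solve-∀

fdes-top : ∀ {n} {e : Vec ℕ (suc n)} {i} → Valid e → IsTop e i → fdes e ≡ suc (toℕ i)
fdes-top {e = e} {i} V top =
  fdes-peak e i (sorted-before-top V top) (λ j i<j → top j (Fin.<⇒≢ i<j ∘ sym))

fdes-zero : ∀ {n} (e : Vec ℕ (suc n)) → max e ≡ 0 → fdes e ≡ suc n
fdes-zero {n} e max≡0 =
  -- The last index serves as the peak: no index follows it, so the descent condition is vacuous.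
  trans (fdes-peak e (fromℕ n) (max≡0⇒sorted e max≡0)
          (λ j n<j → contradiction n<j (≤⇒≯ (Fin.≤fromℕ j))))
        (cong suc (toℕ-fromℕ n))

peak⇒rank : ∀ {n t} (e : Vec ℕ (suc n)) → Peak t e → rank e ≡ + t
peak⇒rank {t = t} e (peak V i top _ off) =
  from (rank⇔ e (fdes-top V top)) (trans off (cong (_+ t) (sym (top-max e top))))

-- The zero sequence of length `n + 1` has rank `n`, so `t < n` excludes it; any other valid
-- sequence has a top.
rank⇒peak : ∀ {n t} (e : Vec ℕ (suc n)) → t < n → Valid e → rank e ≡ + t → Peak t e
rank⇒peak {t = t} e t<n V rank≡ with max-attained e | max e ≟ 0
... | _      | yes max≡0 =
  contradiction (trans (to (rank⇔ e (fdes-zero e max≡0)) rank≡) (cong (_+ t) max≡0)) (<⇒≢ t<n ∘ sym)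
... | i , eq | no max≢0 =
  peak V i top (subst (0 <_) (sym eq) (n≢0⇒n>0 max≢0))
    (trans (to (rank⇔ e (fdes-top V top)) rank≡) (cong (_+ t) (sym eq)))
  where
  top : IsTop e i
  top = max-top V (n≢0⇒n>0 max≢0) eq

-- The Fibonacci index and the final count

double-∸ : ∀ m t → 2 * suc m ∸ 2 * t ∸ 2 ≡ (m ∸ t) + (m ∸ t)
double-∸ m t = begin
  2 * suc m ∸ 2 * t ∸ 2   ≡⟨ ∸-+-assoc (2 * suc m) (2 * t) 2 ⟩
  2 * suc m ∸ (2 * t + 2) ≡⟨ cong (2 * suc m ∸_) (trans (+-comm (2 * t) 2) (sym (*-suc 2 t))) ⟩
  2 * suc m ∸ 2 * suc t   ≡⟨ *-distribˡ-∸ 2 (suc m) (suc t) ⟨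
  2 * (m ∸ t)             ≡⟨ cong (_+_ (m ∸ t)) (+-identityʳ (m ∸ t)) ⟩
  (m ∸ t) + (m ∸ t)       ∎
  where open ≡-Reasoning

proposition5p4 : (n t : ℕ) → 2 ≤ n → t ≤ n ∸ 2 →
    HasCardinality
    (λ (e : Vec ℕ n) →
    IsInversionSequence e ×
    Avoids (1 ∷ 0 ∷ 2 ∷ []) e ×
    Avoids (0 ∷ 1 ∷ 1 ∷ []) e ×
    rank e ≡ + t)
    (fib (2 * n ∸ 2 * t ∸ 2))
proposition5p4 (suc (suc m)) t (s≤s (s≤s z≤n)) t≤m =
  subst (HasCardinality _) (cong fib (sym (double-∸ (suc m) t)))
    (card-cong
      (λ e → mk⇔
        (λ P → let V = Peak.valid P in
          bounded V , valid⇒avoids-102 V , valid⇒avoids-011 V , peak⇒rank e P)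
        (λ { (inv , av102 , av011 , rank≡) →
          rank⇒peak e (s≤s t≤m) (avoids⇒valid inv av102 av011) rank≡ }))
      -- Deleting the top leaves length `suc m`, so the excess over `t` is `suc m ∸ t`.
      (card-peak (card-insertable (suc m ∸ t) (sym (m∸n+n≡m (m≤n⇒m≤1+n t≤m))))))
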